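{- Let $(P,\wedge)$ be a meet semilattice and $\to$ an extended sectional pseudocomplementation on $P$. Then $\to$ is a normal esp-complementation if and only if the following identities hold for all $x,y,z\in P$: (0) $y\le x\to y$; (1) $x\le (x\to y)\to y$; (2) $x\to z\le (x\wedge y)\to z$. Hence the class of algebras $(P,\wedge,\to)$, where $(P,\wedge)$ is a meet semilattice and $\to$ is a normal esp-complementation on it, is the subvariety determined by the identities (0)--(2) of the variety of all meet semilattices equipped with an extended sectional pseudocomplementation.
   Context: For a poset $P$ and $y\in P$ put $[y)=\{u\in P: y\le u\}$. For $y\le x$, the pseudocomplement $x*y$ of $x$ in $[y)$ is the greatest $u\in[y)$ such that $y$ is the only common lower bound of $u$ and $x$ belonging to $[y)$. $P$ is sectionally pseudocomplemented if $x*y$ exists whenever $y\le x$; then $*$ (a partial operation defined exactly for $y\le x$) is its sectional pseudocomplementation. A total binary operation $\to$ on $P$ is an extended sectional pseudocomplementation (esp-complementation) if, for all $y\le x$, $x\to y$ is the pseudocomplement of $x$ in $[y)$. It is normal if $P$ is sectionally pseudocomplemented and for all $x,y\in P$ the element $x\to y$ is the greatest element of $\{z*y: x\le z,\ y\le z\}$ (which in particular exists). In a meet semilattice, an inequality $a\le b$ is read as the equation $a\wedge b=a$. The class of meet semilattices with an extended sectional pseudocomplementation is the variety determined by the semilattice axioms and the identities $x\wedge(x\to(x\wedge y))=x\wedge y$ and $x\le y\to(x\wedge y)$. -}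

module Defs where

open import Level using (Level; _⊔_; suc)
open import Algebra.Core using (Op₂)
open import Algebra.Definitions using (Congruent₂)
open import Algebra.Lattice.Bundles using (MeetSemilattice)
open import Algebra.Lattice.Structures using (IsMeetSemilattice)
import Algebra.Lattice.Properties.Semilattice as SemilatticeProperties
open import Data.List.Base using (List; []; _∷_)
open import Data.List.Relation.Unary.All using (All)
open import Data.Nat.Base using (ℕ)
open import Data.Product.Base using (Σ; ∃; _×_)
open import Function.Bundles using (_⇔_)
open import Relation.Binary.Bundles using (Poset)
open import Relation.Binary.Core using (Rel)
open import Relation.Binary.Structures using (IsEquivalence)
open import Relation.Unary using (Pred)

module Sectional {c ℓ₁ ℓ₂} (P : Poset c ℓ₁ ℓ₂) where
  open Poset P

  IsGreatest : ∀ {ℓ} → Pred Carrier ℓ → Pred Carrier (c ⊔ ℓ₂ ⊔ ℓ)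
  IsGreatest S u = S u × (∀ {v} → S v → v ≤ u)

  OnlyCommonLowerBound : Carrier → Carrier → Carrier → Set (c ⊔ ℓ₁ ⊔ ℓ₂)
  OnlyCommonLowerBound y u x = ∀ w → (y ≤ w × w ≤ u × w ≤ x) ⇔ w ≈ y

  -- IsPseudocomplement x y u reads "u = x * y": it is the graph of the
  -- partial operation *, whose domain is y ≤ x.
  IsPseudocomplement : Carrier → Carrier → Carrier → Set (c ⊔ ℓ₁ ⊔ ℓ₂)
  IsPseudocomplement x y u =
    y ≤ x × IsGreatest (λ v → y ≤ v × OnlyCommonLowerBound y v x) u

  SectionallyPseudocomplemented : Set (c ⊔ ℓ₁ ⊔ ℓ₂)
  SectionallyPseudocomplemented =
    ∀ {x y} → y ≤ x → ∃ λ u → IsPseudocomplement x y u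

  IsEsp : Op₂ Carrier → Set (c ⊔ ℓ₁ ⊔ ℓ₂)
  IsEsp _⇒_ = ∀ {x y} → y ≤ x → IsPseudocomplement x y (x ⇒ y)

  -- The set { z * y : x ≤ z , y ≤ z }.
  UpperPseudocomplements : Carrier → Carrier → Pred Carrier (c ⊔ ℓ₁ ⊔ ℓ₂)
  UpperPseudocomplements x y v =
    ∃ λ z → x ≤ z × y ≤ z × IsPseudocomplement z y v

  record IsNormalEsp (_⇒_ : Op₂ Carrier) : Set (c ⊔ ℓ₁ ⊔ ℓ₂) where
    field
      isEsp                         : IsEsp _⇒_
      sectionallyPseudocomplemented : SectionallyPseudocomplemented
      normal : ∀ x y → IsGreatest (UpperPseudocomplements x y) (x ⇒ y)

-- The natural order: x ≤ y unfolds to x ≈ x ∧ y.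
∧-poset : ∀ {c ℓ} → MeetSemilattice c ℓ → Poset c ℓ ℓ
∧-poset L = SemilatticeProperties.poset (MeetSemilattice.semilattice L)

-- Algebras (A, ∧, →) of type (2, 2), with no laws; the operations respect
-- the setoid equality that plays the role of equality.
record MeetArrowAlgebra c ℓ : Set (suc (c ⊔ ℓ)) where
  infixr 7 _∧_
  infixr 5 _⇒_
  infix  4 _≈_
  field
    Carrier       : Set c
    _≈_           : Rel Carrier ℓ
    isEquivalence : IsEquivalence _≈_
    _∧_           : Op₂ Carrier
    _⇒_           : Op₂ Carrier
    ∧-cong        : Congruent₂ _≈_ _∧_
    ⇒-cong        : Congruent₂ _≈_ _⇒_

module _ {c ℓ} (A : MeetArrowAlgebra c ℓ) where
  open MeetArrowAlgebra A

  IsSemilatticeReduct : Set (c ⊔ ℓ)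
  IsSemilatticeReduct = IsMeetSemilattice _≈_ _∧_

  reductPoset : IsSemilatticeReduct → Poset c ℓ ℓ
  reductPoset isMeetSemilattice =
    ∧-poset (record { isMeetSemilattice = isMeetSemilattice })

EspSemilattice : ∀ {c ℓ} → Pred (MeetArrowAlgebra c ℓ) (c ⊔ ℓ)
EspSemilattice A = Σ (IsSemilatticeReduct A) λ isML →
  Sectional.IsEsp (reductPoset A isML) (MeetArrowAlgebra._⇒_ A)

NormalEspSemilattice : ∀ {c ℓ} → Pred (MeetArrowAlgebra c ℓ) (c ⊔ ℓ)
NormalEspSemilattice A = Σ (IsSemilatticeReduct A) λ isML →
  Sectional.IsNormalEsp (reductPoset A isML) (MeetArrowAlgebra._⇒_ A)

infixr 7 _∧ᵗ_
infixr 5 _⇒ᵗ_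
infix  4 _≈ᵗ_ _≤ᵗ_

data Term : Set where
  var  : ℕ → Term
  _∧ᵗ_ : Term → Term → Term
  _⇒ᵗ_ : Term → Term → Term

data Identity : Set where
  _≈ᵗ_ : Term → Term → Identity

_≤ᵗ_ : Term → Term → Identity
s ≤ᵗ t = s ∧ᵗ t ≈ᵗ s

module _ {c ℓ} (A : MeetArrowAlgebra c ℓ) where
  open MeetArrowAlgebra A

  ⟦_⟧ : Term → (ℕ → Carrier) → Carrier
  ⟦ var i  ⟧ ρ = ρ i
  ⟦ s ∧ᵗ t ⟧ ρ = ⟦ s ⟧ ρ ∧ ⟦ t ⟧ ρ
  ⟦ s ⇒ᵗ t ⟧ ρ = ⟦ s ⟧ ρ ⇒ ⟦ t ⟧ ρ

  infix 4 _⊨_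

  _⊨_ : Identity → Set (c ⊔ ℓ)
  _⊨_ (s ≈ᵗ t) = ∀ ρ → ⟦ s ⟧ ρ ≈ ⟦ t ⟧ ρ

-- The variety determined by a list of identities.
Mod : ∀ {c ℓ} → List Identity → Pred (MeetArrowAlgebra c ℓ) (c ⊔ ℓ)
Mod E A = All (A ⊨_) E

private
  x y z : Term
  x = var 0
  y = var 1
  z = var 2

espIdentities : List Identity
espIdentities =
    ((x ∧ᵗ y) ∧ᵗ z ≈ᵗ x ∧ᵗ (y ∧ᵗ z))
  ∷ (x ∧ᵗ y ≈ᵗ y ∧ᵗ x)
  ∷ (x ∧ᵗ x ≈ᵗ x)
  ∷ (x ∧ᵗ (x ⇒ᵗ (x ∧ᵗ y)) ≈ᵗ x ∧ᵗ y)
  ∷ (x ≤ᵗ y ⇒ᵗ (x ∧ᵗ y))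
  ∷ []

normalIdentities : List Identity
normalIdentities =
    (y ≤ᵗ x ⇒ᵗ y)
  ∷ (x ≤ᵗ (x ⇒ᵗ y) ⇒ᵗ y)
  ∷ (x ⇒ᵗ z ≤ᵗ (x ∧ᵗ y) ⇒ᵗ z)
  ∷ []

{-# OPTIONS --safe #-}
-- In a meet semilattice the condition that y be the only common lower bound
-- of u and x in [y) is the equation x ∧ u = y, so for y ≤ x the element x → y
-- is the greatest u with x ∧ u = y, which the two esp identities express.
-- Identities (0) and (1) say
-- that z = (x → y) → y is an upper bound of x and y; (2) makes → antitone in
-- its first argument, so (1) gives z → y = x → y as in a Galois connection, and
-- x → y is thus attained as z * y.
module Submission where

open import Defs
open import Algebra.Core using (Op₂)
open import Algebra.Definitions using (Congruent₂)
open import Algebra.Lattice.Bundles using (MeetSemilattice)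
import Algebra.Lattice.Properties.Semilattice as SemilatticeProperties
open import Data.List.Base using (_++_)
open import Data.List.Relation.Unary.All using ([]; _∷_)
import Data.List.Relation.Unary.All.Properties as All
open import Data.Nat.Base using (ℕ; suc)
open import Data.Product.Base using (_×_; _,_; proj₁; proj₂)
open import Function.Bundles using (_⇔_; mk⇔; module Equivalence)
import Relation.Binary.Lattice.Bundles as Order
open import Relation.Binary.Bundles using (Poset)
open import Relation.Binary.Structures using (IsEquivalence)
open import Relation.Unary using (_∩_; _≐_)

open Equivalence using (to; from)

module _ {c ℓ₁ ℓ₂} (P : Poset c ℓ₁ ℓ₂) where
  open Poset P
  open Sectional P

  -- Used for (1): when `u` is the pseudocomplement of `z` in [y), `z` is in turn a candidate for
  -- that of `u`.
  onlyCommonLowerBound-sym : ∀ {y u x} →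
    OnlyCommonLowerBound y u x → OnlyCommonLowerBound y x u
  onlyCommonLowerBound-sym only w = mk⇔
    (λ (y≤w , w≤x , w≤u) → to (only w) (y≤w , w≤u , w≤x))
    (λ w≈y → let y≤w , w≤u , w≤x = from (only w) w≈y in y≤w , w≤x , w≤u)

  -- Normality asks for `x ⇒ y` itself, whereas the pseudocomplement at hand is a triple arrow,
  -- equal to it only up to `≈`.
  isPseudocomplement-respʳ : ∀ {x y u v} → u ≈ v →
    IsPseudocomplement x y u → IsPseudocomplement x y v
  isPseudocomplement-respʳ u≈v (y≤x , (y≤u , only) , greatest) =
    y≤x
    , ( trans y≤u (reflexive u≈v)
      , λ w → mk⇔
          (λ (y≤w , w≤v , w≤x) →
            to (only w) (y≤w , trans w≤v (reflexive (Eq.sym u≈v)) , w≤x))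
          (λ w≈y → let y≤w , w≤u , w≤x = from (only w) w≈y in
            y≤w , trans w≤u (reflexive u≈v) , w≤x))
    , λ v∈S → trans (greatest v∈S) (reflexive u≈v)

module _ {c ℓ} (L : MeetSemilattice c ℓ) where
  open MeetSemilattice L using (_∧_; ∧-cong; comm; semilattice)
  open Poset (∧-poset L)
  open Order.MeetSemilattice
    (SemilatticeProperties.∧-orderTheoreticMeetSemilattice semilattice)
    using (x∧y≤x; x∧y≤y; ∧-greatest)
  open Sectional (∧-poset L)

  onlyCommonLowerBound⇔∧≈ : ∀ {y u x} → OnlyCommonLowerBound y u x ⇔ x ∧ u ≈ y
  onlyCommonLowerBound⇔∧≈ {y} {u} {x} = mk⇔
    -- The instance `w = y` puts `y` below `u` and `x`, so `x ∧ u` lies in [y) and is forced to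
    -- equal `y`.
    (λ (only : OnlyCommonLowerBound y u x) → let _ , y≤u , y≤x = from (only y) Eq.refl in
      to (only (x ∧ u)) (∧-greatest y≤x y≤u , x∧y≤y x u , x∧y≤x x u))
    (λ x∧u≈y w → mk⇔
      (λ (y≤w , w≤u , w≤x) →
        antisym (trans (∧-greatest w≤x w≤u) (reflexive x∧u≈y)) y≤w)
      (λ w≈y →
        let w≤x∧u = reflexive (Eq.trans w≈y (Eq.sym x∧u≈y)) in
        reflexive (Eq.sym w≈y)
        , trans w≤x∧u (x∧y≤y x u)
        , trans w≤x∧u (x∧y≤x x u)))

  module _ (_⇒_ : Op₂ Carrier) (⇒-cong : Congruent₂ _≈_ _⇒_) where

    isEsp⇒identities : IsEsp _⇒_ →
      (∀ x y → x ∧ (x ⇒ (x ∧ y)) ≈ x ∧ y) × (∀ x y → x ≤ (y ⇒ (x ∧ y)))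
    isEsp⇒identities esp =
      (λ x y → let _ , (_ , only) , _ = esp (x∧y≤x x y) in
        to onlyCommonLowerBound⇔∧≈ only)
      -- `x` is a candidate for the pseudocomplement of `y` in [x ∧ y), hence below it.
      , λ x y → let _ , _ , greatest = esp (x∧y≤y x y) in
        greatest (x∧y≤x x y , from onlyCommonLowerBound⇔∧≈ (comm y x))

    identities⇒isEsp :
      (∀ x y → x ∧ (x ⇒ (x ∧ y)) ≈ x ∧ y) → (∀ x y → x ≤ (y ⇒ (x ∧ y))) →
      IsEsp _⇒_
    identities⇒isEsp meet adjoint {x} {y} y≤x =
      y≤x
      , ( trans (reflexive (Eq.sym x∧[x⇒y]≈y)) (x∧y≤y x (x ⇒ y))
        , from onlyCommonLowerBound⇔∧≈ x∧[x⇒y]≈y)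
      , λ {v} (_ , only) →
          -- A candidate `v` satisfies `x ∧ v ≈ y`, so its bound `x ⇒ (v ∧ x)` is `x ⇒ y`.
          trans (adjoint v x)
            (reflexive (⇒-cong Eq.refl
              (Eq.trans (comm v x) (to onlyCommonLowerBound⇔∧≈ only))))
      where
      -- The first identity only concerns `x ⇒ (x ∧ y)`; this brings `x ⇒ y` into that form.
      y≈x∧y : y ≈ x ∧ y
      y≈x∧y = Eq.trans y≤x (comm y x)

      x∧[x⇒y]≈y : x ∧ (x ⇒ y) ≈ y
      x∧[x⇒y]≈y = Eq.trans (∧-cong Eq.refl (⇒-cong Eq.refl y≈x∧y))
                    (Eq.trans (meet x y) (Eq.sym y≈x∧y))

    isNormalEsp⇔identities : IsEsp _⇒_ → IsNormalEsp _⇒_ ⇔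
      ((∀ x y → y ≤ (x ⇒ y)) ×
       (∀ x y → x ≤ ((x ⇒ y) ⇒ y)) ×
       (∀ x y z → (x ⇒ z) ≤ ((x ∧ y) ⇒ z)))
    isNormalEsp⇔identities esp = mk⇔ normal⇒ ⇒normal
      where
      normal⇒ : IsNormalEsp _⇒_ →
        (∀ x y → y ≤ (x ⇒ y)) ×
        (∀ x y → x ≤ ((x ⇒ y) ⇒ y)) ×
        (∀ x y z → (x ⇒ z) ≤ ((x ∧ y) ⇒ z))
      normal⇒ isNormal = y≤x⇒y
        -- Here `x ⇒ y` is attained as the pseudocomplement of some `z` above `x`. By symmetry `z`
        -- is a candidate for that of `x ⇒ y`, which is `(x ⇒ y) ⇒ y`.
        , (λ x y →
            let (z , x≤z , y≤z , _ , (_ , only) , _) , _ = normal x y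
                _ , _ , greatest = esp (y≤x⇒y x y)
            in trans x≤z
                 (greatest (y≤z , onlyCommonLowerBound-sym (∧-poset L) only)))
        -- An upper bound `u` of `x` and `z` is also one of `x ∧ y` and `z`, so `x ⇒ z` belongs to
        -- the set whose greatest element is `(x ∧ y) ⇒ z`.
        , (λ x y z →
            let (u , x≤u , z≤u , pc) , _ = normal x z in
            proj₂ (normal (x ∧ y) z) (u , trans (x∧y≤x x y) x≤u , z≤u , pc))
        where
        open IsNormalEsp isNormal using (normal)

        y≤x⇒y : ∀ x y → y ≤ (x ⇒ y)
        y≤x⇒y x y = let (_ , _ , _ , _ , (y≤ , _) , _) , _ = normal x y in y≤

      ⇒normal :
        (∀ x y → y ≤ (x ⇒ y)) ×
        (∀ x y → x ≤ ((x ⇒ y) ⇒ y)) ×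
        (∀ x y z → (x ⇒ z) ≤ ((x ∧ y) ⇒ z)) →
        IsNormalEsp _⇒_
      ⇒normal (y≤x⇒y , x≤[x⇒y]⇒y , x⇒z≤x∧y⇒z) = record
        { isEsp                         = esp
        ; sectionallyPseudocomplemented = λ {x} {y} y≤x → x ⇒ y , esp y≤x
        ; normal                        = λ x y →
            ( (x ⇒ y) ⇒ y
            , x≤[x⇒y]⇒y x y
            , y≤x⇒y (x ⇒ y) y
            , isPseudocomplement-respʳ (∧-poset L)
                -- The triple arrow collapses: antitonicity applied to (1) bounds it by `x ⇒ y`, and
                -- (1) at `x ⇒ y` gives the converse.
                (antisym (⇒-antitone (x≤[x⇒y]⇒y x y)) (x≤[x⇒y]⇒y (x ⇒ y) y))
                (esp (y≤x⇒y (x ⇒ y) y)))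
            -- Any `v` in the set is a candidate for `z` in [y), so it lies below `z ⇒ y`.
            , λ (z , x≤z , y≤z , _ , v∈S , _) →
                trans (proj₂ (proj₂ (esp y≤z)) v∈S) (⇒-antitone x≤z)
        }
        where
        ⇒-antitone : ∀ {x y z} → x ≤ z → (z ⇒ y) ≤ (x ⇒ y)
        ⇒-antitone {x} {y} {z} x≤z = trans (x⇒z≤x∧y⇒z z x y)
          (reflexive (⇒-cong (Eq.sym (Eq.trans x≤z (comm x z))) Eq.refl))

-- The identities mention only variables 0, 1 and 2; the value at later indices is an arbitrary
-- default.
valuation : ∀ {a} {A : Set a} → A → A → A → ℕ → A
valuation x y z 0             = x
valuation x y z 1             = y
valuation x y z (suc (suc _)) = z

module _ {c ℓ} (A : MeetArrowAlgebra c ℓ) where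
  open MeetArrowAlgebra A
  open IsEquivalence isEquivalence using (sym)

  isSemilatticeReduct : Mod espIdentities A → IsSemilatticeReduct A
  isSemilatticeReduct (assoc ∷ comm ∷ idem ∷ _) = record
    { isBand = record
      { isSemigroup = record
        { isMagma = record { isEquivalence = isEquivalence ; ∙-cong = ∧-cong }
        ; assoc   = λ x y z → assoc (valuation x y z)
        }
      ; idem = λ x → idem (valuation x x x)
      }
    ; comm = λ x y → comm (valuation x y y)
    }

  isEsp⇒Mod : EspSemilattice A → Mod espIdentities A
  isEsp⇒Mod (isML , esp) =
    (λ ρ → assoc (ρ 0) (ρ 1) (ρ 2))
    ∷ (λ ρ → comm (ρ 0) (ρ 1))
    ∷ (λ ρ → idem (ρ 0))
    ∷ (λ ρ → proj₁ identities (ρ 0) (ρ 1))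
    -- `sym` is due to orientation: the order unfolds to `a ≈ a ∧ b`, but `≤ᵗ` to `a ∧ b ≈ a`.
    ∷ (λ ρ → sym (proj₂ identities (ρ 0) (ρ 1)))
    ∷ []
    where
    L = record { isMeetSemilattice = isML }
    open MeetSemilattice L using (assoc; comm; idem)
    identities = isEsp⇒identities L _⇒_ ⇒-cong esp

  Mod⇒isEsp : Mod espIdentities A → EspSemilattice A
  Mod⇒isEsp ids@(_ ∷ _ ∷ _ ∷ meet ∷ adjoint ∷ []) =
    isSemilatticeReduct ids
    , identities⇒isEsp (record { isMeetSemilattice = isSemilatticeReduct ids })
        _⇒_ ⇒-cong
        (λ x y → meet (valuation x y y))
        (λ x y → sym (adjoint (valuation x y y)))

  isNormalEsp⇒Mod : NormalEspSemilattice A → Mod normalIdentities A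
  isNormalEsp⇒Mod (isML , isNormal) =
    let id₀ , id₁ , id₂ =
          to (isNormalEsp⇔identities (record { isMeetSemilattice = isML })
               _⇒_ ⇒-cong (Sectional.IsNormalEsp.isEsp isNormal)) isNormal
    in
    (λ ρ → sym (id₀ (ρ 0) (ρ 1)))
    ∷ (λ ρ → sym (id₁ (ρ 0) (ρ 1)))
    ∷ (λ ρ → sym (id₂ (ρ 0) (ρ 1) (ρ 2)))
    ∷ []

  Mod⇒isNormalEsp :
    (EspSemilattice ∩ Mod normalIdentities) A → NormalEspSemilattice A
  Mod⇒isNormalEsp ((isML , esp) , id₀ ∷ id₁ ∷ id₂ ∷ []) =
    isML
    , from (isNormalEsp⇔identities (record { isMeetSemilattice = isML })
             _⇒_ ⇒-cong esp)
        ( (λ x y → sym (id₀ (valuation x y y)))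
        , (λ x y → sym (id₁ (valuation x y y)))
        , (λ x y z → sym (id₂ (valuation x y z))))

espSemilattice≐Mod : ∀ {c ℓ} → EspSemilattice {c} {ℓ} ≐ Mod espIdentities
espSemilattice≐Mod = (λ {A} → isEsp⇒Mod A) , (λ {A} → Mod⇒isEsp A)

normalEspSemilattice≐Esp∩Mod : ∀ {c ℓ} →
  NormalEspSemilattice {c} {ℓ} ≐ (EspSemilattice ∩ Mod normalIdentities)
normalEspSemilattice≐Esp∩Mod =
  (λ {A} normal@(isML , isNormal) →
    (isML , Sectional.IsNormalEsp.isEsp isNormal) , isNormalEsp⇒Mod A normal)
  , (λ {A} → Mod⇒isNormalEsp A)

normalEspSemilattice≐Mod : ∀ {c ℓ} →
  NormalEspSemilattice {c} {ℓ} ≐ Mod (espIdentities ++ normalIdentities)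
normalEspSemilattice≐Mod =
  (λ {A} normal → let esp , ids = proj₁ normalEspSemilattice≐Esp∩Mod {A} normal in
    All.++⁺ (isEsp⇒Mod A esp) ids)
  , (λ {A} ids → Mod⇒isNormalEsp A
      ( Mod⇒isEsp A (All.++⁻ˡ espIdentities ids)
      , All.++⁻ʳ espIdentities ids))

theorem6p13 : ∀ {c ℓ} →
    ((L : MeetSemilattice c ℓ) →
      let open MeetSemilattice L
          open Poset (∧-poset L) using (_≤_)
          open Sectional (∧-poset L) in
      (_⇒_ : Op₂ Carrier) → Congruent₂ _≈_ _⇒_ → IsEsp _⇒_ →
      IsNormalEsp _⇒_ ⇔
        ((∀ x y → y ≤ (x ⇒ y)) ×
         (∀ x y → x ≤ ((x ⇒ y) ⇒ y)) ×
         (∀ x y z → (x ⇒ z) ≤ ((x ∧ y) ⇒ z))))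
    × (EspSemilattice {c} {ℓ} ≐ Mod espIdentities)
    × (NormalEspSemilattice {c} {ℓ} ≐ (EspSemilattice ∩ Mod normalIdentities))
    × (NormalEspSemilattice {c} {ℓ} ≐ Mod (espIdentities ++ normalIdentities))
theorem6p13 =
  isNormalEsp⇔identities
  , espSemilattice≐Mod
  , normalEspSemilattice≐Esp∩Mod
  , normalEspSemilattice≐Mod
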